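{- There exist functions $g:\mathbb{N}^2\to\mathbb{N}^2$ and $h_1,h_2:\mathbb{N}^2\to\mathbb{N}$ such that the following holds for all graphs $G,H$: (i) If $G$ admits an honest $H$-decomposition of radial width $r_0\in\mathbb{N}$ and radial spread $r_1\in\mathbb{N}$, then $G$ is $g(r_0,r_1)$-quasi-isometric to $H$. (ii) If $G$ is $(L,C)$-quasi-isometric to $H$ (for integers $L\ge1$, $C\ge0$), then $G$ admits an honest $H$-decomposition of radial width at most $h_1(L,C)$ and radial spread at most $h_2(L,C)$.
   Context: All graphs are finite and simple; $\mathbb{N}=\{0,1,2,\dots\}$. $d_G$ denotes the distance in $G$ ($\infty$ between different components). Graph-decompositions: an $H$-decomposition of $G$ is a pair $(H,(V_h)_{h\in V(H)})$ with $H$ a graph and $V_h\subseteq V(G)$ (the bags) such that $\bigcup_{h}G[V_h]=G$ and, for every $v\in V(G)$, the graph $H_v:=H[\{h: v\in V_h\}]$ is connected. It is honest if all bags are non-empty and $V_h\cap V_{h'}\ne\emptyset$ for every edge $hh'$ of $H$. The radius $\mathrm{rad}(G)$ of a graph is the least $r\in\mathbb N$ such that some vertex has distance at most $r$ to all vertices ($\infty$ if the graph is disconnected). The radial width of the decomposition is $\max_h \mathrm{rad}(G[V_h])$ and its radial spread is $\max_{v\in V(G)}\mathrm{rad}(H_v)$. Quasi-isometry: for integers $L\ge1$, $C\ge0$, a graph $A$ is $(L,C)$-quasi-isometric to a graph $B$ if there is a map $\varphi:V(A)\to V(B)$ such that for all $a,a'\in V(A)$: $d_A(a,a')\le L\,d_B(\varphi(a),\varphi(a'))+LC$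 and $d_B(\varphi(a),\varphi(a'))\le L\,d_A(a,a')+C$; and every $b\in V(B)$ satisfies $d_B(b,\varphi(a))\le C$ for some $a\in V(A)$. -}

module Defs where

open import Data.Bool.Base using (Bool; T)
open import Data.Bool.Properties using (T-irrelevant; T?)
open import Data.Fin.Base using (Fin; zero; suc; toℕ)
open import Data.Fin.Properties using (pigeonhole)
open import Data.List.Base using (List; []; _∷_; foldr; length; lookup; map)
open import Data.List.Membership.Propositional using (_∈_; find; lose)
open import Data.List.Relation.Unary.All as All using ()
open import Data.List.Relation.Unary.Any using (here; there; index; any?)
open import Data.List.Relation.Unary.Any.Properties using (lookup-index)
open import Data.List.Relation.Unary.Enumerates.Setoid using (IsEnumeration)
open import Data.Maybe.Base as Maybe using (zipWith)
open import Data.Nat.Base using (ℕ; zero; suc; _+_; _*_; _⊔_; _≤_; _<_; z≤n; s≤s)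
open import Data.Nat.Induction using (<-rec)
open import Data.Nat.Properties
  using (≤-trans; ≤-<-trans; ≤-<-connex; <⇒≤; <-irrefl; ≤∧≢⇒<; n<1+n; m<n⇒m<1+n; _≤?_;
         +-comm; +-identityʳ; +-suc; +-monoˡ-<)
open import Data.Product.Base using (Σ; ∃; ∃-syntax; _×_; _,_; proj₁; proj₂)
open import Data.Sum.Base using (_⊎_; inj₁; inj₂)
open import Function.Base using (_∘_)
open import Relation.Binary.Definitions
  using (Decidable; DecidableEquality; Irreflexive; Symmetric)
open import Relation.Binary.PropositionalEquality
  using (_≡_; refl; sym; trans; cong; subst; setoid)
open import Relation.Nullary using (¬_; Dec; yes; no; contradiction)
open import Relation.Nullary.Decidable using (map′; _×-dec_)
open import Relation.Nullary.Construct.Add.Supremum public using (_⁺; [_]; ⊤⁺)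
open import Relation.Binary.Construct.Add.Supremum.NonStrict _≤_ public
  using (_≤⁺_; [_]; _≤⊤⁺; ≤⁺-dec)

-- A list enumerating the vertices may repeat them; together with decidable
-- equality it says that the vertex set is finite.
record Graph : Set₁ where
  field
    Vertex     : Set
    _≟_        : DecidableEquality Vertex
    vertices   : List Vertex
    enumerates : IsEnumeration (setoid Vertex) vertices
    Adj        : Vertex → Vertex → Set
    adj?       : Decidable Adj
    adj-sym    : Symmetric Adj
    adj-irrefl : Irreflexive _≡_ Adj

open Graph public using (Vertex; vertices; enumerates; Adj)

-- The least element of P in ℕ, with ⊤⁺ (i.e. ∞) if there is none.
IsLeast : (ℕ → Set) → ℕ ⁺ → Set
IsLeast P [ n ] = P n × (∀ m → P m → n ≤ m)
IsLeast P ⊤⁺    = ∀ n → ¬ P n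

search : {P : ℕ → Set} → (∀ n → Dec (P n)) → ∀ N →
         (∃[ n ] n < N × IsLeast P [ n ]) ⊎ (∀ n → P n → N ≤ n)
search P? zero = inj₂ λ _ _ → z≤n
search P? (suc N) with search P? N
... | inj₁ (n , n<N , least) = inj₁ (n , m<n⇒m<1+n n<N , least)
... | inj₂ below with P? N
...   | yes p = inj₁ (N , n<1+n N , p , below)
...   | no ¬p = inj₂ λ n q → ≤∧≢⇒< (below n q) λ { refl → ¬p q }

-- Existence of the least element constructively needs P to be decidable and a
-- bound below which some element lies as soon as P has elements at all.
least : (P : ℕ → Set) → (∀ n → Dec (P n)) →
        (N : ℕ) → (∀ n → P n → ∃[ m ] m < N × P m) → ∃ (IsLeast P)
least P P? N bound with search P? N
... | inj₁ (n , _ , isLeast) = [ n ] , isLeast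
... | inj₂ below = ⊤⁺ , λ n p → let m , m<N , q = bound n p in
  contradiction (≤-<-trans (below m q) m<N) (<-irrefl refl)

module _ (G : Graph) where
  open Graph G using (_≟_; adj?)

  data Walk : Vertex G → Vertex G → ℕ → Set where
    nil  : ∀ {u} → Walk u u 0
    cons : ∀ {u v w n} → Adj G u v → Walk v w n → Walk u w (suc n)

  Connected : Set
  Connected = ∀ u v → ∃[ n ] Walk u v n

  any-vertex? : {P : Vertex G → Set} → (∀ v → Dec (P v)) → Dec (∃ P)
  any-vertex? P? = map′ (λ a → let v , _ , p = find a in v , p)
                        (λ (v , p) → lose (enumerates G v) p)
                        (any? P? (vertices G))

  all-vertices? : {P : Vertex G → Set} → (∀ v → Dec (P v)) → Dec (∀ v → P v)
  all-vertices? P? = map′ (λ a v → All.lookup a (enumerates G v))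
                          (λ f → All.tabulate λ {v} _ → f v)
                          (All.all? P? (vertices G))

  walk? : ∀ u v n → Dec (Walk u v n)
  walk? u v zero = map′ (λ { refl → nil }) (λ { nil → refl }) (u ≟ v)
  walk? u v (suc n) =
    map′ (λ (_ , a , p) → cons a p) (λ { (cons a p) → _ , a , p })
         (any-vertex? λ w → adj? u w ×-dec walk? w v n)

  visit : ∀ {u v n} → Walk u v n → Fin (suc n) → Vertex G
  visit {u} _          zero    = u
  visit     (cons _ p) (suc i) = visit p i

  suffix : ∀ {u v n} (p : Walk u v n) (i : Fin (suc n)) →
           ∃[ m ] m + toℕ i ≡ n × Walk (visit p i) v m
  suffix {n = n} p zero = n , +-identityʳ n , p
  suffix (cons _ p) (suc i) =
    let m , eq , q = suffix p i in m , trans (+-suc m (toℕ i)) (cong suc eq) , q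

  splice : ∀ {u v n m} (p : Walk u v n) (i : Fin (suc n)) →
           Walk (visit p i) v m → Walk u v (toℕ i + m)
  splice _          zero    q = q
  splice (cons a p) (suc i) q = cons a (splice p i q)

  shorten : ∀ {u v n} (p : Walk u v n) → length (vertices G) ≤ n →
            ∃[ m ] m < n × Walk u v m
  shorten {n = n} p N≤n
    with i , j , i<j , eq ← pigeonhole (s≤s N≤n) (index ∘ enumerates G ∘ visit p)
    with m , m+j≡n , q ← suffix p j
    = toℕ i + m
    , subst (toℕ i + m <_) (trans (+-comm (toℕ j) m) m+j≡n) (+-monoˡ-< m i<j)
    , splice p i (subst (λ w → Walk w _ m) (sym same) q)
    where
    same : visit p i ≡ visit p j
    same = trans (lookup-index (enumerates G (visit p i)))
             (trans (cong (lookup (vertices G)) eq)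
                    (sym (lookup-index (enumerates G (visit p j)))))

  short-walk : ∀ u v n → Walk u v n → ∃[ m ] m < length (vertices G) × Walk u v m
  short-walk u v = <-rec _ λ n rec p → case n rec p (≤-<-connex (length (vertices G)) n)
    where
    case : ∀ n → (∀ {m} → m < n → Walk u v m → ∃[ k ] k < length (vertices G) × Walk u v k) →
           Walk u v n → length (vertices G) ≤ n ⊎ n < length (vertices G) →
           ∃[ k ] k < length (vertices G) × Walk u v k
    case n rec p (inj₁ N≤n) = let m , m<n , q = shorten p N≤n in rec m<n q
    case n rec p (inj₂ n<N) = n , n<N , p

  distance : ∀ u v → ∃ (IsLeast (Walk u v))
  distance u v = least (Walk u v) (walk? u v) (length (vertices G)) (short-walk u v)

  dist : Vertex G → Vertex G → ℕ ⁺
  dist u v = proj₁ (distance u v)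

  dist-bound : ∀ u v {n} → dist u v ≤⁺ [ n ] → dist u v ≤⁺ [ length (vertices G) ]
  dist-bound u v le with distance u v
  dist-bound u v [ _ ] | [ d ] , w , d-least =
    let m , m<N , q = short-walk u v d w in [ ≤-trans (d-least m q) (<⇒≤ m<N) ]

  WithinRadius : ℕ → Set
  WithinRadius r = ∃[ c ] ∀ v → dist c v ≤⁺ [ r ]

  withinRadius? : ∀ r → Dec (WithinRadius r)
  withinRadius? r = any-vertex? λ c → all-vertices? λ v → ≤⁺-dec _≤?_ (dist c v) [ r ]

  radius : ∃ (IsLeast WithinRadius)
  radius = least WithinRadius withinRadius? (suc (length (vertices G)))
    λ _ (c , near) → length (vertices G) , n<1+n _ , c , λ v → dist-bound c v (near v)

  rad : ℕ ⁺
  rad = proj₁ radius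

  -- The maximum over the empty vertex set is 0.
  maximum : (Vertex G → ℕ ⁺) → ℕ ⁺
  maximum f = foldr (zipWith _⊔_) [ 0 ] (map f (vertices G))

restrict : {A : Set} (S : A → Bool) → List A → List (Σ A (T ∘ S))
restrict S [] = []
restrict S (x ∷ xs) with T? (S x)
... | yes s = (x , s) ∷ restrict S xs
... | no  _ = restrict S xs

∈-restrict : {A : Set} (S : A → Bool) {xs : List A} →
             ∀ {x} (s : T (S x)) → x ∈ xs → (x , s) ∈ restrict S xs
∈-restrict S {y ∷ ys} s x∈ with T? (S y)
∈-restrict S s (here refl) | yes s′ = here (cong (_ ,_) (T-irrelevant s s′))
∈-restrict S s (there x∈)  | yes _  = there (∈-restrict S s x∈)
∈-restrict S s (here refl) | no ¬s  = contradiction s ¬s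
∈-restrict S s (there x∈)  | no _   = ∈-restrict S s x∈

infix 20 _⟨_⟩

-- The induced subgraph G[S].
_⟨_⟩ : (G : Graph) → (Vertex G → Bool) → Graph
G ⟨ S ⟩ = record
  { Vertex     = Σ (Vertex G) (T ∘ S)
  ; _≟_        = λ (u , s) (v , t) →
                   map′ (λ { refl → cong (u ,_) (T-irrelevant s t) }) (cong proj₁)
                        (Graph._≟_ G u v)
  ; vertices   = restrict S (vertices G)
  ; enumerates = λ (v , s) → ∈-restrict S s (enumerates G v)
  ; Adj        = λ (u , _) (v , _) → Adj G u v
  ; adj?       = λ (u , _) (v , _) → Graph.adj? G u v
  ; adj-sym    = Graph.adj-sym G
  ; adj-irrefl = λ eq → Graph.adj-irrefl G (cong proj₁ eq)
  }

-- The two covering fields say that the union of the G[V_h] is G; the other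
-- inclusion holds because every G[V_h] is a subgraph of G.
record Decomposition (H G : Graph) : Set where
  field
    bag : Vertex H → Vertex G → Bool

  part : Vertex H → Graph
  part h = G ⟨ bag h ⟩

  nodes : Vertex G → Graph
  nodes v = H ⟨ (λ h → bag h v) ⟩

  field
    covers-vertices : ∀ v → ∃[ h ] T (bag h v)
    covers-edges    : ∀ {u v} → Adj G u v → ∃[ h ] T (bag h u) × T (bag h v)
    nodes-connected : ∀ v → Connected (nodes v)

  Honest : Set
  Honest = (∀ h → ∃[ v ] T (bag h v))
         × (∀ {h h′} → Adj H h h′ → ∃[ v ] T (bag h v) × T (bag h′ v))

  radialWidth : ℕ ⁺
  radialWidth = maximum H (λ h → rad (part h))

  radialSpread : ℕ ⁺
  radialSpread = maximum G (λ v → rad (nodes v))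

open Decomposition public using (Honest; radialWidth; radialSpread)

-- L · d + K in ℕ ∪ {∞}, where ∞ stays ∞; used with L ≥ 1 only.
affine : ℕ → ℕ → ℕ ⁺ → ℕ ⁺
affine L K = Maybe.map (λ d → L * d + K)

IsQuasiIsometry : ℕ × ℕ → (A B : Graph) → (Vertex A → Vertex B) → Set
IsQuasiIsometry (L , C) A B φ =
    (∀ a a′ → dist A a a′ ≤⁺ affine L (L * C) (dist B (φ a) (φ a′)))
  × (∀ a a′ → dist B (φ a) (φ a′) ≤⁺ affine L C (dist A a a′))
  × (∀ b → ∃[ a ] dist B b (φ a) ≤⁺ [ C ])

-- L ≥ 1 is part of the notion, so it also constrains any pair of constants that
-- is claimed to exist.
QuasiIsometric : ℕ × ℕ → Graph → Graph → Set
QuasiIsometric (L , C) A B = 1 ≤ L × ∃[ φ ] IsQuasiIsometry (L , C) A B φ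

{-# OPTIONS --safe #-}

-- (i) Send v to any node whose bag contains v. A decomposition is a relation
-- between V(G) and V(H) that is symmetric in the two graphs once it is honest:
-- an edge on either side has a common partner on the other, and the partners of
-- one vertex are at distance at most twice the radial spread or width. Following
-- a walk on one side therefore gives a walk on the other of comparable length.
--
-- (ii) Put R = L + C and S = 2LR + LC, and let V_h be the union of the balls
-- B_G(a, S) over all a with d_H(φ(a), h) ≤ R. The constant S is large enough for
-- the ball around any such a to contain all the others, so G[V_h] is connected
-- with radius at most 2S. Dually, H_v is the union of the balls B_H(φ(a), R) over
-- a ∈ B_G(v, S); since φ maps neighbours to distance at most R, walks from v can be
-- followed inside it.
module Submission where

open import Defs
open import Data.Bool.Base using (Bool; T)
open import Data.Bool.Properties using (T-irrelevant)
open import Data.List.Base using (List; []; _∷_; foldr; map)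
open import Data.List.Membership.Propositional using (_∈_)
open import Data.List.Relation.Unary.Any using (here; there)
open import Data.Maybe.Base using (zipWith)
open import Data.Nat.Base using (ℕ; suc; _+_; _*_; _⊔_; _≤_; z≤n; s≤s)
open import Data.Nat.Properties
  using (≤-refl; ≤-trans; ≤-reflexive; m≤m+n; m≤n+m; n≤1+n; m≤m⊔n; m≤n⊔m; ⊔-lub; m≤m*n;
         +-comm; +-mono-≤; +-monoˡ-≤; +-monoʳ-≤; *-comm; *-monoˡ-≤; *-monoʳ-≤;
         *-identityʳ; _≤?_)
open import Data.Product.Base using (Σ; _×_; _,_; ∃-syntax; proj₁; proj₂)
open import Relation.Binary.Construct.Add.Supremum.NonStrict _≤_ using (≤⁺-trans)
open import Relation.Binary.PropositionalEquality using (_≡_; refl; subst)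
open import Relation.Nullary using (Dec)
open import Relation.Nullary.Decidable using (⌊_⌋; map′; toWitness; fromWitness; _×-dec_)

-- Walks of bounded length, radii and induced subgraphs.

module _ (G : Graph) where

  -- Equivalent to `dist G u v ≤⁺ [ n ]`, but carrying a walk, so that bounds compose by
  -- concatenation without a case for infinite distance.
  Close : Vertex G → Vertex G → ℕ → Set
  Close u v n = ∃[ m ] m ≤ n × Walk G u v m

module _ {G : Graph} where

  _++ʷ_ : ∀ {u v w m n} → Walk G u v m → Walk G v w n → Walk G u w (m + n)
  nil      ++ʷ q = q
  cons a p ++ʷ q = cons a (p ++ʷ q)

  reverseʷ : ∀ {u v n} → Walk G u v n → Walk G v u n
  reverseʷ nil = nil
  reverseʷ {n = suc n} (cons a p) =
    subst (Walk G _ _) (+-comm n 1) (reverseʷ p ++ʷ cons (Graph.adj-sym G a) nil)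

  close-refl : ∀ {u n} → Close G u u n
  close-refl = 0 , z≤n , nil

  close-edge : ∀ {u v} → Adj G u v → Close G u v 1
  close-edge a = 1 , ≤-refl , cons a nil

  close-sym : ∀ {u v n} → Close G u v n → Close G v u n
  close-sym (m , m≤n , p) = m , m≤n , reverseʷ p

  close-trans : ∀ {u v w m n} → Close G u v m → Close G v w n → Close G u w (m + n)
  close-trans (_ , k≤m , p) (_ , l≤n , q) = _ , +-mono-≤ k≤m l≤n , p ++ʷ q

  close-mono : ∀ {u v m n} → m ≤ n → Close G u v m → Close G u v n
  close-mono m≤n (k , k≤m , p) = k , ≤-trans k≤m m≤n , p

  close⇒dist : ∀ {u v n} → Close G u v n → dist G u v ≤⁺ [ n ]
  close⇒dist {u} {v} (m , m≤n , p) with distance G u v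
  ... | [ d ] , _ , d-least = [ ≤-trans (d-least m p) m≤n ]
  ... | ⊤⁺    , none with () ← none m p

  dist⇒close : ∀ {u v n} → dist G u v ≤⁺ [ n ] → Close G u v n
  dist⇒close {u} {v} le with distance G u v
  dist⇒close [ d≤n ] | [ d ] , p , _ = d , d≤n , p

  close? : ∀ u v n → Dec (Close G u v n)
  close? u v n = map′ dist⇒close close⇒dist (≤⁺-dec _≤?_ (dist G u v) [ n ])

  near⇒rad : ∀ {r} c → (∀ v → Close G c v r) → rad G ≤⁺ [ r ]
  near⇒rad {r} c near with radius G
  ... | [ s ] , _ , s-least = [ s-least r (c , λ v → close⇒dist (near v)) ]
  ... | ⊤⁺    , none with () ← none r (c , λ v → close⇒dist (near v))

  rad⇒close : ∀ {r} → rad G ≤⁺ [ r ] → ∀ u v → Close G u v (r + r)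
  rad⇒close le u v with radius G
  rad⇒close [ s≤r ] u v | [ s ] , (c , near) , _ =
    close-mono (+-mono-≤ s≤r s≤r)
      (close-trans (close-sym (dist⇒close (near u))) (dist⇒close (near v)))

  near⇒connected : ∀ {r} c → (∀ v → Close G c v r) → Connected G
  near⇒connected c near u v =
    let m , _ , p = close-trans (close-sym (near u)) (near v) in m , p

  module _ {S : Vertex G → Bool} where

    forget : ∀ {u v n} → Walk (G ⟨ S ⟩) u v n → Walk G (proj₁ u) (proj₁ v) n
    forget nil        = nil
    forget (cons a p) = cons a (forget p)

    close-forget : ∀ {u v n} → Close (G ⟨ S ⟩) u v n → Close G (proj₁ u) (proj₁ v) n
    close-forget (m , m≤n , p) = m , m≤n , forget p

    close-reindex : ∀ {u v n} {s s′ : T (S u)} →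
                    Close (G ⟨ S ⟩) (u , s) v n → Close (G ⟨ S ⟩) (u , s′) v n
    close-reindex {s = s} {s′} p with refl ← T-irrelevant s s′ = p

    -- A walk of length `n` stays within `n` of its start. After one edge the relevant ball about
    -- the next vertex is one smaller and lies in the old ball, so induction applies.
    walk-inside : ∀ {u v n} → (∀ {w} → Close G u w n → T (S w)) → Walk G u v n →
                  ∀ s t → Walk (G ⟨ S ⟩) (u , s) (v , t) n
    walk-inside inside nil s t with refl ← T-irrelevant s t = nil
    walk-inside inside (cons a p) s t =
      cons {v = _ , inside (close-mono (s≤s z≤n) (close-edge a))} a
        (walk-inside (λ c → inside (close-trans (close-edge a) c)) p _ t)

    ball-inside : ∀ {u v n} → (∀ {w} → Close G u w n → T (S w)) → Close G u v n →
                  ∀ s t → Close (G ⟨ S ⟩) (u , s) (v , t) n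
    ball-inside inside (m , m≤n , p) s t =
      m , m≤n , walk-inside (λ c → inside (close-mono m≤n c)) p s t

-- Finite bounds on maxima.

module _ {A : Set} (f : A → ℕ ⁺) where

  private
    max : List A → ℕ ⁺
    max xs = foldr (zipWith _⊔_) [ 0 ] (map f xs)

  -- `zipWith` returns `⊤⁺` as soon as one argument is `⊤⁺`, so a finite maximum leaves only the
  -- case of two finite values.
  foldr-⊔-upper : ∀ {r x} xs → max xs ≡ [ r ] → x ∈ xs → f x ≤⁺ [ r ]
  foldr-⊔-upper (y ∷ ys) eq x∈ with f y in fy | max ys in m
  foldr-⊔-upper (y ∷ ys) refl (here refl) | [ a ] | [ b ]
    rewrite fy = [ m≤m⊔n a b ]
  foldr-⊔-upper (y ∷ ys) refl (there x∈)  | [ a ] | [ b ]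
    = ≤⁺-trans ≤-trans (foldr-⊔-upper ys m x∈) [ m≤n⊔m a b ]

  foldr-⊔-lub : ∀ {r} xs → (∀ x → f x ≤⁺ [ r ]) → max xs ≤⁺ [ r ]
  foldr-⊔-lub []       below = [ z≤n ]
  foldr-⊔-lub (x ∷ xs) below with f x | below x | max xs | foldr-⊔-lub xs below
  ... | _ | [ a≤r ] | _ | [ b≤r ] = [ ⊔-lub a≤r b≤r ]

maximum-upper : ∀ G f {r} → maximum G f ≡ [ r ] → ∀ v → f v ≤⁺ [ r ]
maximum-upper G f eq v = foldr-⊔-upper f (vertices G) eq (enumerates G v)

maximum-lub : ∀ G f {r} → (∀ v → f v ≤⁺ [ r ]) → maximum G f ≤⁺ [ r ]
maximum-lub G f = foldr-⊔-lub f (vertices G)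

-- Distance estimates between two graphs.

module _ (A B : Graph) (L K : ℕ) {a a′ : Vertex A} {b b′ : Vertex B} where

  -- A shortest walk realises a finite distance in `B`; an infinite one makes the right side
  -- infinite.
  walks⇒affine : (∀ {n} → Walk B b b′ n → Close A a a′ (L * n + K)) →
                 dist A a a′ ≤⁺ affine L K (dist B b b′)
  walks⇒affine f with distance B b b′
  ... | [ d ] , p , _ = close⇒dist (f p)
  ... | ⊤⁺    , _     = _ ≤⊤⁺

  affine⇒close : dist A a a′ ≤⁺ affine L K (dist B b b′) →
                 ∀ {n} → Close B b b′ n → Close A a a′ (L * n + K)
  affine⇒close le {n} (m , m≤n , p) with distance B b b′
  ... | [ d ] , _ , d-least =
    close-mono (+-monoˡ-≤ K (*-monoʳ-≤ L (≤-trans (d-least m p) m≤n))) (dist⇒close le)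
  ... | ⊤⁺    , none with () ← none m p

-- A walk with `n` edges has `n + 1` vertices. A common partner chosen for each edge leaves one hop
-- per vertex, between two partners of that vertex.
transfer-walk : ∀ {A B : Graph} (R : Vertex A → Vertex B → Set) {d} →
  (∀ {a b b′} → R a b → R a b′ → Close B b b′ d) →
  (∀ {a a′} → Adj A a a′ → ∃[ b ] R a b × R a′ b) →
  ∀ {a a′ b b′ n} → Walk A a a′ n → R a b → R a′ b′ → Close B b b′ (suc n * d)
transfer-walk R {d} fibre edge nil r r′ = close-mono (m≤m+n d 0) (fibre r r′)
transfer-walk R fibre edge (cons e p) r r′ =
  let _ , s , s′ = edge e in
  close-trans (fibre r s) (transfer-walk R fibre edge p s′ r′)

suc-*-bound : ∀ n {d L K} → d ≤ L → d ≤ K → suc n * d ≤ L * n + K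
suc-*-bound n {d} {L} {K} d≤L d≤K =
  ≤-trans (≤-reflexive (+-comm d (n * d)))
    (+-mono-≤ (≤-trans (*-monoʳ-≤ n d≤L) (≤-reflexive (*-comm n L))) d≤K)

-- From decompositions to quasi-isometries.

qiConstant : ℕ → ℕ → ℕ
-- Twice a radius bounds a diameter. The successor makes the constant positive, as a multiplicative
-- constant must be, and hence at most its own square, the additive error `L * C`.
qiConstant r₀ r₁ = suc ((r₀ + r₀) + (r₁ + r₁))

decomposition⇒quasi-isometric : ∀ {G H : Graph} (D : Decomposition H G) → Honest D →
  ∀ {r₀ r₁} → radialWidth D ≡ [ r₀ ] → radialSpread D ≡ [ r₁ ] →
  QuasiIsometric (qiConstant r₀ r₁ , qiConstant r₀ r₁) G H
decomposition⇒quasi-isometric {G} {H} D (nonempty , meet) {r₀} {r₁} width spread =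
    s≤s z≤n , φ
  , (λ _ _ → walks⇒affine G H K (K * K) λ {n} p →
       close-mono (suc-*-bound n 2r₀≤K (≤-trans 2r₀≤K (m≤m*n K K)))
         (transfer-walk (λ h v → T (bag h v)) bag-close meet p (φ-bag _) (φ-bag _)))
  , (λ _ _ → walks⇒affine H G K K λ {n} p →
       close-mono (suc-*-bound n 2r₁≤K 2r₁≤K)
         (transfer-walk (λ v h → T (bag h v)) nodes-close covers-edges p (φ-bag _) (φ-bag _)))
  -- Both `b` and `φ v` are nodes of `v`.
  , λ b → let v , v∈ = nonempty b in
      v , close⇒dist (close-mono 2r₁≤K (nodes-close v∈ (φ-bag v)))
  where
  open Decomposition D using (bag; part; nodes; covers-vertices; covers-edges)

  K = qiConstant r₀ r₁

  2r₀≤K : r₀ + r₀ ≤ K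
  2r₀≤K = ≤-trans (m≤m+n _ _) (n≤1+n _)

  2r₁≤K : r₁ + r₁ ≤ K
  2r₁≤K = ≤-trans (m≤n+m _ (r₀ + r₀)) (n≤1+n _)

  φ : Vertex G → Vertex H
  φ v = proj₁ (covers-vertices v)

  φ-bag : ∀ v → T (bag (φ v) v)
  φ-bag v = proj₂ (covers-vertices v)

  bag-close : ∀ {h u v} → T (bag h u) → T (bag h v) → Close G u v (r₀ + r₀)
  bag-close {h} s t =
    close-forget (rad⇒close (maximum-upper H (λ h → rad (part h)) width h) (_ , s) (_ , t))

  nodes-close : ∀ {v h k} → T (bag h v) → T (bag k v) → Close H h k (r₁ + r₁)
  nodes-close {v} s t =
    close-forget (rad⇒close (maximum-upper G (λ v → rad (nodes v)) spread v) (_ , s) (_ , t))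

-- From quasi-isometries to decompositions.

stepLength thickness : ℕ × ℕ → ℕ
-- The image of an edge spans at most `L * 1 + C`. For `1 ≤ L` this is also at least `C + 1`, which
-- honesty uses.
stepLength (L , C) = L + C
-- Bounds the distance of two vertices whose images lie within `stepLength` of one node.
thickness (L , C) = L * (stepLength (L , C) + stepLength (L , C)) + L * C

module QuasiIsometry⇒Decomposition (G H : Graph) {L C : ℕ} (1≤L : 1 ≤ L)
  (φ : Vertex G → Vertex H) (qi : IsQuasiIsometry (L , C) G H φ) where

  R S : ℕ
  R = stepLength (L , C)
  S = thickness (L , C)

  C≤R : C ≤ R
  C≤R = m≤n+m C L

  φ-reflects : ∀ {a a′ n} → Close H (φ a) (φ a′) n → Close G a a′ (L * n + L * C)
  φ-reflects = affine⇒close G H L (L * C) (proj₁ qi _ _)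

  φ-edge : ∀ {a a′} → Adj G a a′ → Close H (φ a) (φ a′) R
  φ-edge e = close-mono (+-monoˡ-≤ C (≤-reflexive (*-identityʳ L)))
    (affine⇒close H G L C (proj₁ (proj₂ qi) _ _) (close-edge e))

  anchor : Vertex H → Vertex G
  anchor h = proj₁ (proj₂ (proj₂ qi) h)

  anchor-close : ∀ h → Close H (φ (anchor h)) h C
  anchor-close h = close-sym (dist⇒close (proj₂ (proj₂ (proj₂ qi) h)))

  InBag : Vertex H → Vertex G → Set
  InBag h v = ∃[ a ] Close G v a S × Close H (φ a) h R

  inBag? : ∀ h v → Dec (InBag h v)
  inBag? h v = any-vertex? G λ a → close? v a S ×-dec close? (φ a) h R

  bag : Vertex H → Vertex G → Bool
  bag h v = ⌊ inBag? h v ⌋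

  anchor∈bag : ∀ h → T (bag h (anchor h))
  anchor∈bag h = fromWitness (anchor h , close-refl , close-mono C≤R (anchor-close h))

  ∈bag-φ : ∀ v → T (bag (φ v) v)
  ∈bag-φ v = fromWitness (v , close-refl , close-refl)

  part-near : ∀ h v → Close (G ⟨ bag h ⟩) (anchor h , anchor∈bag h) v (S + S)
  part-near h (v , v∈) =
    let a , v~a , φa~h = toWitness v∈
        a∈  = fromWitness (a , close-refl , φa~h)
        -- The route through `h` has length at most `C + R`; rounding up to `R + R` makes
        -- `φ-reflects` give exactly `S`.
        φ~φ = close-mono (+-monoˡ-≤ R C≤R) (close-trans (anchor-close h) (close-sym φa~h))
    in close-trans
         -- Each of the two legs stays in an `S`-ball whose centre has its image within `R` of `h`,
         -- so that the ball lies in the bag.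
         (ball-inside (λ c → fromWitness
            (anchor h , close-sym c , close-mono C≤R (anchor-close h)))
            (φ-reflects φ~φ) (anchor∈bag h) a∈)
         (ball-inside (λ c → fromWitness (a , close-sym c , φa~h)) (close-sym v~a) a∈ v∈)

  -- Consecutive images are joined inside the `R`-ball about the earlier one, so each edge costs at
  -- most `R`.
  follow : ∀ {T′ : Vertex H → Bool} {u a n} →
    (∀ {w h} → Close G u w n → Close H (φ w) h R → T (T′ h)) →
    Walk G u a n → ∀ s t → Close (H ⟨ T′ ⟩) (φ u , s) (φ a , t) (n * R)
  follow inside nil s t = close-reindex close-refl
  follow inside (cons e p) s t = close-trans
    (ball-inside (inside close-refl) (φ-edge e) s (inside close-refl (φ-edge e)))
    (follow (λ c → inside (close-trans (close-edge e) c)) p _ t)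

  nodes-near : ∀ v h → Close (H ⟨ (λ h → bag h v) ⟩) (φ v , ∈bag-φ v) h (S * R + R)
  nodes-near v (h , h∈) =
    let a , (m , m≤S , p) , φa~h = toWitness h∈
        a∈ = fromWitness (a , (m , m≤S , p) , close-refl)
    in close-trans
         (close-mono (*-monoˡ-≤ R m≤S)
           -- A vertex within `S` of `v` is itself a witness that the `R`-ball about its image
           -- consists of nodes of `v`.
           (follow (λ c d → fromWitness (_ , close-mono m≤S c , d)) p (∈bag-φ v) a∈))
         (ball-inside (λ c → fromWitness (a , (m , m≤S , p) , c)) φa~h a∈ h∈)

  decomposition : Decomposition H G
  decomposition = record
    { bag             = bag
    ; covers-vertices = λ v → φ v , ∈bag-φ v
    ; covers-edges    = λ {u} {v} e →
        φ u , ∈bag-φ u , fromWitness (v , close-refl , close-sym (φ-edge e))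
    ; nodes-connected = λ v → near⇒connected _ (nodes-near v)
    }

  honest : Honest decomposition
  honest = (λ h → anchor h , anchor∈bag h)
         -- The route through `h` to its neighbour has length at most `C + 1`, hence at most `R`, so
         -- `anchor h` lies in both bags.
         , λ {h} e → anchor h , anchor∈bag h , fromWitness
             (anchor h , close-refl
             , close-mono (≤-trans (+-monoʳ-≤ C 1≤L) (≤-reflexive (+-comm C L)))
                 (close-trans (anchor-close h) (close-edge e)))

  width-bound : radialWidth decomposition ≤⁺ [ S + S ]
  width-bound = maximum-lub H _ λ h → near⇒rad _ (part-near h)

  spread-bound : radialSpread decomposition ≤⁺ [ S * R + R ]
  spread-bound = maximum-lub G _ λ v → near⇒rad _ (nodes-near v)

proposition1p2 : Σ (ℕ × ℕ → ℕ × ℕ) λ g → Σ (ℕ × ℕ → ℕ) λ h₁ → Σ (ℕ × ℕ → ℕ) λ h₂ →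
    (G H : Graph) →
    ((r₀ r₁ : ℕ) →
    (Σ (Decomposition H G) λ D →
    Honest D × radialWidth D ≡ [ r₀ ] × radialSpread D ≡ [ r₁ ]) →
    QuasiIsometric (g (r₀ , r₁)) G H)
    × ((L C : ℕ) → 1 ≤ L → QuasiIsometric (L , C) G H →
    Σ (Decomposition H G) λ D →
    Honest D × radialWidth D ≤⁺ [ h₁ (L , C) ] × radialSpread D ≤⁺ [ h₂ (L , C) ])
proposition1p2 =
    (λ (r₀ , r₁) → qiConstant r₀ r₁ , qiConstant r₀ r₁)
  , (λ c → thickness c + thickness c)
  , (λ c → thickness c * stepLength c + stepLength c)
  , λ G H →
      (λ r₀ r₁ (D , honest , width , spread) →
         decomposition⇒quasi-isometric D honest width spread)
    , (λ L C 1≤L (_ , φ , qi) →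
         let open QuasiIsometry⇒Decomposition G H 1≤L φ qi in
         decomposition , honest , width-bound , spread-bound)
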